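{- Let $\Pi$ be a uniformly random permutation of $[n]$. Then asymptotically almost surely (i.e. with probability tending to $1$ as $n\to\infty$) \[ bt(\Pi)=(2+o(1))\frac{\log n}{\log\log n}. \]
   Context: Two permutations (sequences of distinct positive integers) $(x_1,\dots,x_k)$ and $(y_1,\dots,y_k)$ are similar if $x_i<x_j \iff y_i<y_j$ for all $1\le i<j\le k$. A block of $\pi$ is a subsequence of $\pi$ whose index set is a segment of consecutive integers. A pair of block twins in $\pi$ is a pair of similar blocks of $\pi$ with disjoint index sets; its length is the length of one of the blocks. $bt(\pi)$ is the largest length of a pair of block twins in $\pi$. -}

module Defs where

open import Data.Nat using (ℕ; zero; suc; _+_; _*_; _∸_; _≤_; _<_)
open import Data.Fin using (Fin; toℕ)
open import Data.Vec as Vec using (Vec; []; _∷_)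
open import Data.List as List using (List; concatMap; allFin; length)
open import Data.List.Relation.Unary.Unique.Propositional using (Unique)
open import Data.List.Relation.Unary.All using (All)
open import Data.List.Membership.Propositional using (_∈_)
open import Data.Product using (Σ; _×_; ∃; ∃-syntax)
open import Data.Sum using (_⊎_)
open import Function.Bundles using (_⇔_)
open import Data.Nat.Logarithm using (⌊log₂_⌋)

-- A permutation of [n] (shifted to {0,…,n-1}; similarity is unaffected)
-- in one-line notation: a vector of length n with pairwise distinct entries.
IsPerm : ∀ {n} → Vec (Fin n) n → Set
IsPerm π = Unique (Vec.toList π)

-- value of π at (0-based) position i, as a natural number (0 out of range).
val : ∀ {n} → Vec (Fin n) n → ℕ → ℕ
val π i = at (Vec.toList π) i
  where
  at : ∀ {n} → List (Fin n) → ℕ → ℕ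
  at List.[]       _       = 0
  at (x List.∷ xs) zero    = toℕ x
  at (x List.∷ xs) (suc i) = at xs i

SimilarBlocks : ∀ {n} → Vec (Fin n) n → (i j k : ℕ) → Set
SimilarBlocks π i j k =
  ∀ a b → a < k → b < k →
    (val π (i + a) < val π (i + b)) ⇔ (val π (j + a) < val π (j + b))

HasBlockTwins : ∀ {n} → Vec (Fin n) n → ℕ → Set
HasBlockTwins {n} π k =
  ∃[ i ] ∃[ j ] (i + k ≤ n × j + k ≤ n × (i + k ≤ j ⊎ j + k ≤ i)
                 × SimilarBlocks π i j k)

IsBT : ∀ {n} → Vec (Fin n) n → ℕ → Set
IsBT π b = HasBlockTwins π b × (∀ k → HasBlockTwins π k → k ≤ b)

L LL : ℕ → ℕ
L n  = ⌊log₂ n ⌋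
LL n = ⌊log₂ ⌊log₂ n ⌋ ⌋

-- The event |bt(π) − 2 L/LL| ≤ (1/k) L/LL, i.e.
-- (2k−1)·L ≤ k·bt·LL ≤ (2k+1)·L.
GoodBT : ∀ {n} → ℕ → Vec (Fin n) n → Set
GoodBT {n} k π = ∃[ b ] (IsBT π b ×
  ((2 * k ∸ 1) * L n ≤ k * b * LL n × k * b * LL n ≤ (2 * k + 1) * L n))

module Submission where

-- Rearranging one block of a permutation of [n] by the m! permutations of
-- its m positions changes only the order pattern of that block, and every
-- pattern arises exactly once.  This gives two injections.
-- (1) If the permutations in A have block twins of length m, mapping (π, σ)
-- to the twin positions and to π with its second twin rearranged by σ is
-- injective, as the first twin still shows the pattern to restore:
-- |A| m! ≤ n² n!.
-- (2) If the permutations in B have no block twins of length m and n ≥ 2Mm,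
-- then for s, t < M one can rearrange the block M + t to match the block s;
-- this creates the only similar pair (s, M + t), so (π, s, t) is determined
-- by the new permutation and the rearrangement used: |B| M² ≤ n! m!.
-- With Λ = L n and ℓ = LL n, the number m! is much larger than n² once
-- m ≥ (2 + 1/k) Λ/ℓ, and much smaller than (n/m)² if m ≤ (2 − 1/k) Λ/ℓ + 1.

open import Defs
open import Data.Nat
open import Data.Nat.Properties
open import Data.Nat.DivMod using (m/n*n≤m; m%n<n; m≡m%n+[m/n]*n; m≥n⇒m/n>0; m*n/n≡m; /-monoˡ-≤)
open import Data.Nat.Logarithm using (⌊log₂_⌋; ⌊log₂⌋-mono-≤; ⌊log₂[2^n]⌋≡n; ⌊log₂⌊n/2⌋⌋≡⌊log₂n⌋∸1)
open import Data.Nat.Tactic.RingSolver using (solve-∀)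
open import Data.Fin as Fin using (Fin; zero; suc; toℕ; fromℕ<; punchIn; punchOut)
open import Data.Fin.Properties using (toℕ<n; toℕ-injective; toℕ-fromℕ<; punchIn-injective; punchInᵢ≢i; punchIn-punchOut; punchOut-injective; injective⇒≤; any?)
open import Data.Vec as Vec using (Vec; []; _∷_)
import Data.Vec.Properties as Vec
open import Data.Vec.Membership.Propositional.Properties using (∈-lookup; ∈-toList⁺)
open import Data.List as List using (List; []; _∷_; length; filter; cartesianProductWith; cartesianProduct; allFin; upTo)
import Data.List.Properties as List
open import Data.List.Membership.Propositional using (_∈_; lose)
import Data.List.Membership.Propositional.Properties as ∈
import Data.List.Membership.Setoid.Properties as ∈ₛ
open import Data.List.Relation.Unary.All as All using (All; []; _∷_)
import Data.List.Relation.Unary.All.Properties as All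
open import Data.List.Relation.Unary.Any as Any using (Any; here; there)
open import Data.List.Relation.Unary.AllPairs as AllPairs using ([]; _∷_)
import Data.List.Relation.Unary.AllPairs.Properties as AllPairs
open import Data.List.Relation.Unary.Unique.Propositional using (Unique)
import Data.List.Relation.Unary.Unique.Propositional.Properties as Unique
open import Data.Product using (Σ; ∃-syntax; _×_; _,_; proj₁; proj₂)
open import Data.Sum using (_⊎_; inj₁; inj₂)
open import Function using (_∘_; id)
open import Function.Bundles using (_⇔_; mk⇔; Equivalence)
open import Relation.Nullary using (¬_; Dec; yes; no; contradiction)
open import Relation.Nullary.Decidable using (map′; _×-dec_; _⊎-dec_; _→-dec_)
open import Relation.Unary using (Decidable)
open import Relation.Unary.Properties using (∁?)
open import Relation.Binary.Definitions using (tri<; tri≈; tri>)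
open import Relation.Binary.PropositionalEquality hiding ([_])
open Equivalence using (to; from)

private variable
  A B C : Set

-- Counting by injections between lists

lookup-injective : ∀ {xs : List A} → Unique xs → ∀ i j → List.lookup xs i ≡ List.lookup xs j → i ≡ j
lookup-injective (_ ∷ _) zero zero _ = refl
lookup-injective (x∉ ∷ _) zero (suc j) eq = contradiction eq (All.lookup x∉ (∈.∈-lookup j))
lookup-injective (x∉ ∷ _) (suc i) zero eq = contradiction (sym eq) (All.lookup x∉ (∈.∈-lookup i))
lookup-injective (_ ∷ u) (suc i) (suc j) eq = cong suc (lookup-injective u i j eq)

-- Choose some related `y` for each `x` and record its index in `ys`. Since no `y` is related to two
-- members of `xs`, every such choice is injective, so the map may be given as a relation and the
-- choices need no canonical form.
injection⇒length≤ : (R : A → B → Set) {xs : List A} {ys : List B} → Unique xs →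
  (∀ {x} → x ∈ xs → ∃[ y ] (y ∈ ys × R x y)) →
  (∀ {x x′ y} → x ∈ xs → x′ ∈ xs → R x y → R x′ y → x ≡ x′) →
  length xs ≤ length ys
injection⇒length≤ R {xs} {ys} u total inj = injective⇒≤ {f = f} f-inj
  where
  choice : ∀ i → ∃[ y ] (y ∈ ys × R (List.lookup xs i) y)
  choice i = total (∈.∈-lookup i)

  f : Fin (length xs) → Fin (length ys)
  f i = Any.index (proj₁ (proj₂ (choice i)))

  f-inj : ∀ {i j} → f i ≡ f j → i ≡ j
  f-inj {i} {j} eq with choice i | choice j
  ... | y , y∈ , r | y′ , y′∈ , r′ with ∈ₛ.index-injective (setoid _) y∈ y′∈ eq
  ... | refl = lookup-injective u i j (inj (∈.∈-lookup i) (∈.∈-lookup j) r r′)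

length-cartesianProductWith : (f : A → B → C) (xs : List A) (ys : List B) →
  length (cartesianProductWith f xs ys) ≡ length xs * length ys
length-cartesianProductWith f [] ys = refl
length-cartesianProductWith f (x ∷ xs) ys = trans
  (List.length-++ (List.map (f x) ys))
  (cong₂ _+_ (List.length-map (f x) ys) (length-cartesianProductWith f xs ys))

length-filter+∁ : {P : A → Set} (P? : Decidable P) (xs : List A) →
  length xs ≤ length (filter P? xs) + length (filter (∁? P?) xs)
length-filter+∁ P? [] = z≤n
length-filter+∁ P? (x ∷ xs) with P? x
... | yes _ = s≤s (length-filter+∁ P? xs)
... | no _  = ≤-trans (s≤s (length-filter+∁ P? xs)) (≤-reflexive (sym (+-suc _ _)))

-- The list of all permutations

-- Built from the first entry `x` and a permutation of the remaining values, which `punchIn x`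
-- relabels so as to skip `x`. The product form makes the length n! immediate.
perms : ∀ n → List (Vec (Fin n) n)
perms zero    = [] ∷ []
perms (suc n) = cartesianProductWith (λ x π → x ∷ Vec.map (punchIn x) π) (allFin (suc n)) (perms n)

length-perms : ∀ n → length (perms n) ≡ n !
length-perms zero    = refl
length-perms (suc n) = trans (length-cartesianProductWith _ (allFin (suc n)) (perms n))
  (cong₂ _*_ (List.length-tabulate {n = suc n} id) (length-perms n))

map-injective : {f : A → B} → (∀ {x y} → f x ≡ f y → x ≡ y) →
  ∀ {m} (xs ys : Vec A m) → Vec.map f xs ≡ Vec.map f ys → xs ≡ ys
map-injective inj [] [] _ = refl
map-injective inj (x ∷ xs) (y ∷ ys) eq =
  cong₂ _∷_ (inj (Vec.∷-injectiveˡ eq)) (map-injective inj xs ys (Vec.∷-injectiveʳ eq))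

perms-unique : ∀ n → Unique (perms n)
perms-unique zero    = [] ∷ []
perms-unique (suc n) = Unique.cartesianProductWith⁺ _ inj (Unique.allFin⁺ (suc n)) (perms-unique n)
  where
  inj : ∀ {x y : Fin (suc n)} {π ρ : Vec (Fin n) n} →
    x ∷ Vec.map (punchIn x) π ≡ y ∷ Vec.map (punchIn y) ρ → x ≡ y × π ≡ ρ
  inj {x} {y} {π} {ρ} eq with Vec.∷-injectiveˡ eq
  ... | refl = refl , map-injective (punchIn-injective x _ _) π ρ (Vec.∷-injectiveʳ eq)

∈-perms⁻ : ∀ n {π} → π ∈ perms n → IsPerm π
∈-perms⁻ zero    (here refl) = []
∈-perms⁻ (suc n) π∈ with ∈.∈-cartesianProductWith⁻ _ (allFin (suc n)) (perms n) π∈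
... | x , ρ , _ , ρ∈ , refl rewrite Vec.toList-map (punchIn x) ρ =
  All.map⁺ (All.universal (λ y eq → punchInᵢ≢i x y (sym eq)) _)
  ∷ Unique.map⁺ (punchIn-injective x _ _) (∈-perms⁻ n ρ∈)

punchOut-all : ∀ {n m} (x : Fin (suc n)) (xs : Vec (Fin (suc n)) m) → All (x ≢_) (Vec.toList xs) →
  ∃[ ys ] Vec.map (punchIn x) ys ≡ xs
punchOut-all x []       []         = [] , refl
punchOut-all x (y ∷ xs) (x≢y ∷ x∉) with punchOut-all x xs x∉
... | ys , refl = punchOut x≢y ∷ ys , cong (_∷ _) (punchIn-punchOut x≢y)

∈-perms⁺ : ∀ n {π : Vec (Fin n) n} → IsPerm π → π ∈ perms n
∈-perms⁺ zero    {[]}     []       = here refl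
∈-perms⁺ (suc n) {x ∷ xs} (x∉ ∷ u) with punchOut-all x xs x∉
... | ρ , refl rewrite Vec.toList-map (punchIn x) ρ =
  ∈.∈-cartesianProductWith⁺ _ (∈.∈-allFin x)
    (∈-perms⁺ n (AllPairs.map (λ ≢ eq → ≢ (cong (punchIn x) eq)) (AllPairs.map⁻ u)))

-- Permutations as functions on natural numbers

-- Gives a name to the private function in the definition of val: the
-- metavariable is solved by higher-order unification in val≡nth.
mutual
  nth : ∀ {n} → Vec (Fin n) n → List (Fin n) → ℕ → ℕ
  nth π = _

  val≡nth : ∀ {n} (π : Vec (Fin n) n) i → val π i ≡ nth π (Vec.toList π) i
  val≡nth π i with Vec.toList π
  ... | xs = refl

nth-lookup : ∀ {n m} (π : Vec (Fin n) n) (xs : Vec (Fin n) m) p →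
  nth π (Vec.toList xs) (toℕ p) ≡ toℕ (Vec.lookup xs p)
nth-lookup π (x ∷ xs) zero    = refl
nth-lookup π (x ∷ xs) (suc p) = nth-lookup π xs p

val-lookup : ∀ {n} (π : Vec (Fin n) n) p → val π (toℕ p) ≡ toℕ (Vec.lookup π p)
val-lookup π p = trans (val≡nth π (toℕ p)) (nth-lookup π π p)

val-fromℕ< : ∀ {n} (π : Vec (Fin n) n) {p} (p<n : p < n) → val π p ≡ toℕ (Vec.lookup π (fromℕ< p<n))
val-fromℕ< π p<n = trans (cong (val π) (sym (toℕ-fromℕ< p<n))) (val-lookup π (fromℕ< p<n))

val< : ∀ {n} (π : Vec (Fin n) n) {p} → p < n → val π p < n
val< π p<n = subst (_< _) (sym (val-fromℕ< π p<n)) (toℕ<n _)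

val-ext : ∀ {n} (π ρ : Vec (Fin n) n) → (∀ {p} → p < n → val π p ≡ val ρ p) → π ≡ ρ
val-ext π ρ eq = begin
  π                            ≡⟨ Vec.tabulate∘lookup π ⟨
  Vec.tabulate (Vec.lookup π)  ≡⟨ Vec.tabulate-cong lookup-eq ⟩
  Vec.tabulate (Vec.lookup ρ)  ≡⟨ Vec.tabulate∘lookup ρ ⟩
  ρ                            ∎
  where
  open ≡-Reasoning
  lookup-eq : ∀ p → Vec.lookup π p ≡ Vec.lookup ρ p
  lookup-eq p = toℕ-injective (trans (sym (val-lookup π p)) (trans (eq (toℕ<n p)) (val-lookup ρ p)))

vec-lookup-injective : ∀ {m} (xs : Vec A m) → Unique (Vec.toList xs) →
  ∀ p q → Vec.lookup xs p ≡ Vec.lookup xs q → p ≡ q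
vec-lookup-injective (x ∷ xs) _        zero    zero    _  = refl
vec-lookup-injective (x ∷ xs) (x∉ ∷ _) zero    (suc q) eq =
  contradiction eq (All.lookup x∉ (∈-toList⁺ (∈-lookup q xs)))
vec-lookup-injective (x ∷ xs) (x∉ ∷ _) (suc p) zero    eq =
  contradiction (sym eq) (All.lookup x∉ (∈-toList⁺ (∈-lookup p xs)))
vec-lookup-injective (x ∷ xs) (_ ∷ u)  (suc p) (suc q) eq = cong suc (vec-lookup-injective xs u p q eq)

toList-tabulate : ∀ {n} (f : Fin n → A) → Vec.toList (Vec.tabulate f) ≡ List.tabulate f
toList-tabulate {n = zero}  f = refl
toList-tabulate {n = suc n} f = cong (f zero ∷_) (toList-tabulate (f ∘ suc))

val-injective : ∀ {n} {π : Vec (Fin n) n} → IsPerm π → ∀ {p q} → p < n → q < n → val π p ≡ val π q → p ≡ q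
val-injective {π = π} u {p} {q} p<n q<n eq = begin
  p                 ≡⟨ toℕ-fromℕ< p<n ⟨
  toℕ (fromℕ< p<n)  ≡⟨ cong toℕ (vec-lookup-injective π u _ _ (toℕ-injective lookup-eq)) ⟩
  toℕ (fromℕ< q<n)  ≡⟨ toℕ-fromℕ< q<n ⟩
  q                 ∎
  where
  open ≡-Reasoning
  lookup-eq : toℕ (Vec.lookup π (fromℕ< p<n)) ≡ toℕ (Vec.lookup π (fromℕ< q<n))
  lookup-eq = trans (sym (val-fromℕ< π p<n)) (trans eq (val-fromℕ< π q<n))

-- Pigeonhole: if `v` were missed, punching it out of the codomain would embed n + 1 elements into
-- n.
injective⇒surjective : ∀ {n} (f : Fin n → Fin n) → (∀ {p q} → f p ≡ f q → p ≡ q) → ∀ v → ∃[ p ] f p ≡ v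
injective⇒surjective {suc n} f inj v with any? (λ p → f p Fin.≟ v)
... | yes hit = hit
... | no miss = contradiction (injective⇒≤ {f = λ p → punchOut (v≢f p)} (inj ∘ punchOut-injective (v≢f _) (v≢f _))) 1+n≰n
  where
  v≢f : ∀ p → v ≢ f p
  v≢f p eq = miss (p , sym eq)

val-surjective : ∀ {n} {π : Vec (Fin n) n} → IsPerm π → ∀ {v} → v < n → ∃[ p ] (p < n × val π p ≡ v)
val-surjective {π = π} u v<n with injective⇒surjective (Vec.lookup π) (vec-lookup-injective π u _ _) (fromℕ< v<n)
... | p , eq = toℕ p , toℕ<n p , trans (val-lookup π p) (trans (cong toℕ eq) (toℕ-fromℕ< v<n))

-- Serves for the permutations constructed below from a relation between positions and values. Each
-- value is allowed at one position at most, so any choice of allowed values has distinct entries.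
perm-choice : ∀ {n} (R : ℕ → ℕ → Set) →
  (∀ {p} → p < n → ∃[ v ] (v < n × R p v)) →
  (∀ {p q v} → p < n → q < n → R p v → R q v → p ≡ q) →
  Σ (Vec (Fin n) n) λ π → IsPerm π × (∀ {p} → p < n → R p (val π p))
perm-choice {n} R total inj = π , subst Unique (sym (toList-tabulate f)) (Unique.tabulate⁺ f-inj) , R-val
  where
  f : Fin n → Fin n
  f p = fromℕ< (proj₁ (proj₂ (total (toℕ<n p))))

  R-f : ∀ p → R (toℕ p) (toℕ (f p))
  R-f p = subst (R (toℕ p)) (sym (toℕ-fromℕ< _)) (proj₂ (proj₂ (total (toℕ<n p))))

  f-inj : ∀ {p q} → f p ≡ f q → p ≡ q
  f-inj {p} {q} eq = toℕ-injective
    (inj (toℕ<n p) (toℕ<n q) (R-f p) (subst (R (toℕ q) ∘ toℕ) (sym eq) (R-f q)))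

  π : Vec (Fin n) n
  π = Vec.tabulate f

  R-val : ∀ {p} → p < n → R p (val π p)
  R-val p<n = subst₂ R (toℕ-fromℕ< p<n)
    (trans (cong toℕ (sym (Vec.lookup∘tabulate f _))) (sym (val-fromℕ< π p<n))) (R-f (fromℕ< p<n))

private variable
  m n : ℕ
  f g h : ℕ → ℕ

-- Similar sequences and rearrangement of a block

-- `SimilarBlocks` for arbitrary sequences, so that blocks, ranks and composites with a permutation
-- can be chained by transitivity. As a record it lets `f` and `g` be inferred from the type.
record Similar (m : ℕ) (f g : ℕ → ℕ) : Set where
  constructor similar
  field
    order : ∀ a b → a < m → b < m → (f a < f b) ⇔ (g a < g b)

open Similar

similar-sym : Similar m f g → Similar m g f
similar-sym (similar s) = similar λ a b a< b< → mk⇔ (from (s a b a< b<)) (to (s a b a< b<))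

similar-trans : Similar m f g → Similar m g h → Similar m f h
similar-trans (similar s) (similar t) = similar λ a b a< b< →
  mk⇔ (to (t a b a< b<) ∘ to (s a b a< b<)) (from (s a b a< b<) ∘ from (t a b a< b<))

similar-≗ : (∀ {a} → a < m → f a ≡ g a) → Similar m f g
similar-≗ eq = similar λ a b a< b< → mk⇔ (subst₂ _<_ (eq a<) (eq b<)) (subst₂ _<_ (sym (eq a<)) (sym (eq b<)))

block : Vec (Fin n) n → ℕ → ℕ → ℕ
block π i a = val π (i + a)

-- A place where f a = g b < g a would, by similarity, produce a smaller
-- such value: f b < f a = g b.
similar-range⇒≤ : Similar m f g → (∀ {a} → a < m → ∃[ b ] (b < m × f a ≡ g b)) → ∀ {a} → a < m → g a ≤ f a
similar-range⇒≤ {m} {f} {g} s range {a} a<m = go (suc (g a)) a<m ≤-refl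
  where
  go : ∀ bound {a} → a < m → g a < bound → g a ≤ f a
  go (suc bound) {a} a<m (s≤s ga≤) with f a <? g a
  ... | no fa≮ga = ≮⇒≥ fa≮ga
  ... | yes fa<ga with range a<m
  ... | b , b<m , fa≡gb = contradiction (go bound b<m (<-≤-trans gb<ga ga≤)) (<⇒≱ (subst (f b <_) fa≡gb (from (order s b a b<m a<m) gb<ga)))
    where
    gb<ga : g b < g a
    gb<ga = subst (_< g a) fa≡gb fa<ga

module _ {P Q : A → Set} (P? : Decidable P) (Q? : Decidable Q) (P⊆Q : ∀ {x} → P x → Q x) where

  length-filter-mono : ∀ xs → length (filter P? xs) ≤ length (filter Q? xs)
  length-filter-mono [] = z≤n
  length-filter-mono (x ∷ xs) with P? x | Q? x
  ... | yes _  | yes _  = s≤s (length-filter-mono xs)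
  ... | yes px | no ¬qx = contradiction (P⊆Q px) ¬qx
  ... | no _   | yes _  = m≤n⇒m≤1+n (length-filter-mono xs)
  ... | no _   | no _   = length-filter-mono xs

  length-filter-strict : ∀ {xs} → Any (λ x → ¬ P x × Q x) xs → length (filter P? xs) < length (filter Q? xs)
  length-filter-strict {x ∷ xs} (here (¬px , qx)) with P? x | Q? x
  ... | yes px | _      = contradiction px ¬px
  ... | no _   | yes _  = s≤s (length-filter-mono xs)
  ... | no _   | no ¬qx = contradiction qx ¬qx
  length-filter-strict {x ∷ xs} (there w) with P? x | Q? x
  ... | yes _  | yes _  = s≤s (length-filter-strict w)
  ... | yes px | no ¬qx = contradiction (P⊆Q px) ¬qx
  ... | no _   | yes _  = m≤n⇒m≤1+n (length-filter-strict w)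
  ... | no _   | no _   = length-filter-strict w

-- Ranks and order patterns

-- The standardization of `f`: for entries distinct below `m`, it is the pattern with values 0, ...,
-- m - 1 that is similar to `f`.
rank : ℕ → (ℕ → ℕ) → ℕ → ℕ
rank m f a = length (filter (λ b → f b <? f a) (upTo m))

rank< : ∀ f {a} → a < m → rank m f a < m
rank< {m} f {a} a<m = subst (rank m f a <_) (List.length-upTo m)
  (List.filter-notAll (λ b → f b <? f a) (upTo m) (lose (∈.∈-upTo⁺ a<m) (<-irrefl refl)))

rank-mono : ∀ f {a b} → a < m → f a < f b → rank m f a < rank m f b
rank-mono f {a} {b} a<m fa<fb = length-filter-strict (λ c → f c <? f a) (λ c → f c <? f b)
  (λ fc<fa → <-trans fc<fa fa<fb) (lose (∈.∈-upTo⁺ a<m) (<-irrefl refl , fa<fb))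

rank-cong : ∀ m f {a b} → f a ≡ f b → rank m f a ≡ rank m f b
rank-cong m f eq = cong (λ v → length (filter (λ c → f c <? v) (upTo m))) eq

rank-similar : ∀ m f → Similar m f (rank m f)
rank-similar m f = similar λ a b a<m b<m → mk⇔ (rank-mono f a<m) (reflect b<m)
  where
  reflect : ∀ {a b} → b < m → rank m f a < rank m f b → f a < f b
  reflect {a} {b} b<m r< with <-cmp (f a) (f b)
  ... | tri< lt _ _ = lt
  ... | tri≈ _ eq _ = contradiction r< (<-irrefl (rank-cong m f eq))
  ... | tri> _ _ gt = contradiction r< (<-asym (rank-mono f b<m gt))

InjectiveBelow : ℕ → (ℕ → ℕ) → Set
InjectiveBelow m f = ∀ {a b} → a < m → b < m → f a ≡ f b → a ≡ b

rank-injective : InjectiveBelow m f → InjectiveBelow m (rank m f)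
rank-injective {m} {f} inj {a} {b} a<m b<m eq with <-cmp (f a) (f b)
... | tri< lt _ _ = contradiction (rank-mono f a<m lt) (<-irrefl eq)
... | tri≈ _ e _  = inj a<m b<m e
... | tri> _ _ gt = contradiction (rank-mono f b<m gt) (<-irrefl (sym eq))

-- The ranks are distinct numbers below `m`, so they form a permutation, and permutations are
-- surjective.
rank-surjective : InjectiveBelow m f → ∀ {v} → v < m → ∃[ a ] (a < m × rank m f a ≡ v)
rank-surjective {m} {f} inj v<m
  with ρ , ρ-perm , ρ-val ← perm-choice (λ a r → rank m f a ≡ r)
         (λ a<m → _ , rank< f a<m , refl)
         (λ a<m b<m e e′ → rank-injective {f = f} inj a<m b<m (trans e (sym e′)))
  with a , a<m , eq ← val-surjective ρ-perm v<m
  = a , a<m , trans (ρ-val a<m) eq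

-- Let `val σ a` be the position where `f` has the rank that `g` has at `a`. Then `f ∘ val σ` and
-- `g` have the same ranks.
sort-like : InjectiveBelow m f → InjectiveBelow m g →
  Σ (Vec (Fin m) m) λ σ → IsPerm σ × Similar m g (f ∘ val σ)
sort-like {m} {f} {g} f-inj g-inj = σ , σ-perm ,
  similar-trans (rank-similar m g) (similar-trans (similar-≗ (λ a<m → sym (σ-val a<m))) f∘σ-similar)
  where
  choice : Σ (Vec (Fin m) m) λ σ → IsPerm σ × (∀ {a} → a < m → rank m f (val σ a) ≡ rank m g a)
  choice = perm-choice (λ a p → rank m f p ≡ rank m g a)
    (λ a<m → rank-surjective {f = f} f-inj (rank< g a<m))
    (λ a<m b<m e e′ → rank-injective {f = g} g-inj a<m b<m (trans (sym e) e′))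

  σ : Vec (Fin m) m
  σ = proj₁ choice

  σ-perm : IsPerm σ
  σ-perm = proj₁ (proj₂ choice)

  σ-val : ∀ {a} → a < m → rank m f (val σ a) ≡ rank m g a
  σ-val = proj₂ (proj₂ choice)

  f∘σ-similar : Similar m (rank m f ∘ val σ) (f ∘ val σ)
  f∘σ-similar = similar λ a b a<m b<m →
    order (similar-sym (rank-similar m f)) (val σ a) (val σ b) (val< σ a<m) (val< σ b<m)

-- Rearranging a block

Outside : (j m p : ℕ) → Set
Outside j m p = p < j ⊎ j + m ≤ p

locate : ∀ j m p → Outside j m p ⊎ ∃[ a ] (a < m × p ≡ j + a)
locate j m p with p <? j | j + m ≤? p
... | yes p<j | _       = inj₁ (inj₁ p<j)
... | no _    | yes j+m≤p = inj₁ (inj₂ j+m≤p)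
... | no p≮j  | no j+m≰p = inj₂ (p ∸ j , +-cancelˡ-< j _ _ (subst (_< j + m) p≡ (≰⇒> j+m≰p)) , p≡)
  where
  p≡ : p ≡ j + (p ∸ j)
  p≡ = sym (m+[n∸m]≡n (≮⇒≥ p≮j))

inside⇒¬outside : ∀ {j a} → a < m → ¬ Outside j m (j + a)
inside⇒¬outside a<m (inj₁ lt) = <⇒≱ lt (m≤m+n _ _)
inside⇒¬outside {j = j} a<m (inj₂ le) = <⇒≱ a<m (+-cancelˡ-≤ j _ _ le)

Disjoint : (i j m : ℕ) → Set
Disjoint i j m = i + m ≤ j ⊎ j + m ≤ i

disjoint⇒outside : ∀ {i j a} → Disjoint i j m → a < m → Outside j m (i + a)
disjoint⇒outside {i = i} (inj₁ le) a<m = inj₁ (<-≤-trans (+-monoʳ-< i a<m) le)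
disjoint⇒outside (inj₂ le) a<m = inj₂ (≤-trans le (m≤m+n _ _))

-- Specifies `ρ` through its values only, so that the injectivity proofs rest on these two equations
-- and not on how `ρ` is built.
record Rearranged (j : ℕ) (σ : Vec (Fin m) m) (π ρ : Vec (Fin n) n) : Set where
  constructor rearranged
  field
    inside  : ∀ {a} → a < m → val ρ (j + a) ≡ val π (j + val σ a)
    outside : ∀ {p} → p < n → Outside j m p → val ρ p ≡ val π p

open Rearranged

block< : ∀ {j a} → j + m ≤ n → a < m → j + a < n
block< {j = j} j+m≤n a<m = <-≤-trans (+-monoʳ-< j a<m) j+m≤n

-- Each position reads its entry from one source position of `π`. No source is read twice: the block
-- and its outside are both preserved, and inside the block sources differ because `σ` is a
-- permutation.
rearrange : ∀ {j} {σ : Vec (Fin m) m} {π : Vec (Fin n) n} → j + m ≤ n → IsPerm σ → IsPerm π →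
  ∃[ ρ ] (IsPerm ρ × Rearranged j σ π ρ)
rearrange {m} {n} {j} {σ} {π} j+m≤n σ-perm π-perm =
  let ρ , ρ-perm , ρ-val = perm-choice R total inj in
  ρ , ρ-perm , rearranged (λ a<m → inside-val a<m (ρ-val (block< j+m≤n a<m))) (λ p<n out → outside-val out (ρ-val p<n))
  where
  -- Position `p` of the new permutation reads its entry from position `q` of the old one.
  Move : ℕ → ℕ → Set
  Move p q = (Outside j m p × q ≡ p) ⊎ ∃[ a ] (a < m × p ≡ j + a × q ≡ j + val σ a)

  R : ℕ → ℕ → Set
  R p v = ∃[ q ] (q < n × Move p q × val π q ≡ v)

  total : ∀ {p} → p < n → ∃[ v ] (v < n × R p v)
  total {p} p<n with locate j m p
  ... | inj₁ out           = _ , val< π p<n , p , p<n , inj₁ (out , refl) , refl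
  ... | inj₂ (a , a<m , e) = _ , val< π q<n , _ , q<n , inj₂ (a , a<m , e , refl) , refl
    where
    q<n : j + val σ a < n
    q<n = block< j+m≤n (val< σ a<m)

  move-inj : ∀ {p p′ q} → Move p q → Move p′ q → p ≡ p′
  move-inj (inj₁ (_ , refl)) (inj₁ (_ , refl)) = refl
  move-inj (inj₁ (out , refl)) (inj₂ (a , a<m , refl , refl)) = contradiction out (inside⇒¬outside (val< σ a<m))
  move-inj (inj₂ (a , a<m , refl , refl)) (inj₁ (out , refl)) = contradiction out (inside⇒¬outside (val< σ a<m))
  move-inj (inj₂ (a , a<m , refl , refl)) (inj₂ (b , b<m , refl , e)) =
    cong (j +_) (val-injective σ-perm a<m b<m (+-cancelˡ-≡ j _ _ e))

  inj : ∀ {p q v} → p < n → q < n → R p v → R q v → p ≡ q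
  inj _ _ (r , r<n , mv , e) (s , s<n , mv′ , e′) with val-injective π-perm r<n s<n (trans e (sym e′))
  ... | refl = move-inj mv mv′

  inside-val : ∀ {a v} → a < m → R (j + a) v → v ≡ val π (j + val σ a)
  inside-val a<m (_ , _ , inj₁ (out , _) , _) = contradiction out (inside⇒¬outside a<m)
  inside-val a<m (_ , _ , inj₂ (b , _ , e , refl) , refl) with +-cancelˡ-≡ j _ _ e
  ... | refl = refl

  outside-val : ∀ {p v} → Outside j m p → R p v → v ≡ val π p
  outside-val out (_ , _ , inj₁ (_ , refl) , refl) = refl
  outside-val out (_ , _ , inj₂ (b , b<m , refl , _) , _) = contradiction out (inside⇒¬outside b<m)

outside-similar : ∀ {i j} {σ : Vec (Fin m) m} {π ρ : Vec (Fin n) n} → i + m ≤ n → Disjoint i j m →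
  Rearranged j σ π ρ → Similar m (block ρ i) (block π i)
outside-similar i+m≤n dis r = similar-≗ (λ a<m → outside r (block< i+m≤n a<m) (disjoint⇒outside dis a<m))

val-ext-block : ∀ {j} {π ρ : Vec (Fin n) n} →
  (∀ {a} → a < m → val π (j + a) ≡ val ρ (j + a)) →
  (∀ {p} → p < n → Outside j m p → val π p ≡ val ρ p) → π ≡ ρ
val-ext-block {n} {m} {j} {π} {ρ} ins out = val-ext π ρ λ {p} p<n → eq p p<n
  where
  eq : ∀ p → p < n → val π p ≡ val ρ p
  eq p p<n with locate j m p
  ... | inj₁ o                = out p<n o
  ... | inj₂ (a , a<m , refl) = ins a<m

-- As `σ` reaches every position of the block, each entry of `π` can be read off from `ρ`.
rearranged-injective : ∀ {j} {σ : Vec (Fin m) m} {π π′ ρ : Vec (Fin n) n} → IsPerm σ →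
  Rearranged j σ π ρ → Rearranged j σ π′ ρ → π ≡ π′
rearranged-injective {m} {n} {j} {σ} {π} {π′} {ρ} σ-perm r r′ =
  val-ext-block {m = m} {j = j} ins (λ p<n o → trans (sym (outside r p<n o)) (outside r′ p<n o))
  where
  ins : ∀ {c} → c < m → val π (j + c) ≡ val π′ (j + c)
  ins c<m with val-surjective σ-perm c<m
  ... | a , a<m , refl = trans (sym (inside r a<m)) (inside r′ a<m)

-- The block at `i` is untouched, so in `π` and in `π′` it has the pattern it has in `ρ`; by the
-- twin property the blocks at `j` have this pattern too. Both blocks at `j` consist of the entries
-- of the block of `ρ` there. Equal pattern and equal range force equal blocks, hence `π ≡ π′`; then
-- `σ` is read off because the entries of `π` are distinct.
rearranged-twins-injective : ∀ {i j} {σ σ′ : Vec (Fin m) m} {π π′ ρ : Vec (Fin n) n} →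
  i + m ≤ n → j + m ≤ n → Disjoint i j m →
  IsPerm σ → IsPerm σ′ → IsPerm π →
  Similar m (block π i) (block π j) → Similar m (block π′ i) (block π′ j) →
  Rearranged j σ π ρ → Rearranged j σ′ π′ ρ → π ≡ π′ × σ ≡ σ′
rearranged-twins-injective {m} {n} {i} {j} {σ} {σ′} {π} {π′} {ρ} i+m≤n j+m≤n dis σ-perm σ′-perm π-perm s s′ r r′ =
  π≡π′ , val-ext σ σ′ λ a<m →
    +-cancelˡ-≡ j _ _ (val-injective π-perm (block< j+m≤n (val< σ a<m)) (block< j+m≤n (val< σ′ a<m))
      (trans (sym (inside r a<m)) (trans (inside r′ a<m) (cong (λ ϕ → val ϕ _) (sym π≡π′)))))
  where
  blocks-similar : Similar m (block π i) (block π j) → Similar m (block π′ i) (block π′ j) →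
    Similar m (block π j) (block π′ j)
  blocks-similar s s′ = similar-trans (similar-sym s)
    (similar-trans (similar-sym (outside-similar i+m≤n dis r)) (similar-trans (outside-similar i+m≤n dis r′) s′))

  same-range : ∀ {τ τ′ : Vec (Fin m) m} {ϕ ϕ′ : Vec (Fin n) n} → IsPerm τ →
    Rearranged j τ ϕ ρ → Rearranged j τ′ ϕ′ ρ →
    ∀ {a} → a < m → ∃[ b ] (b < m × val ϕ (j + a) ≡ val ϕ′ (j + b))
  same-range {τ′ = τ′} τ-perm q q′ a<m with val-surjective τ-perm a<m
  ... | c , c<m , refl = val τ′ c , val< τ′ c<m , trans (sym (inside q c<m)) (inside q′ c<m)

  ins : ∀ {a} → a < m → val π (j + a) ≡ val π′ (j + a)
  ins a<m = ≤-antisym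
    (similar-range⇒≤ (similar-sym (blocks-similar s s′)) (same-range σ′-perm r′ r) a<m)
    (similar-range⇒≤ (blocks-similar s s′) (same-range σ-perm r r′) a<m)

  π≡π′ : π ≡ π′
  π≡π′ = val-ext-block {m = m} {j = j} ins (λ p<n o → trans (sym (outside r p<n o)) (outside r′ p<n o))

-- The two counting inequalities

length-cartesianProduct : ∀ (xs : List A) (ys : List B) → length (cartesianProduct xs ys) ≡ length xs * length ys
length-cartesianProduct = length-cartesianProductWith _,_

-- Injection (1) sends `(π , σ)` to `((i , j) , ρ)`. Recording `(i , j)` ensures that two preimages
-- of the same image have their twins at the same place, as `rearranged-twins-injective` requires.
count-twins : ∀ n m (ps : List (Vec (Fin n) n)) → 1 ≤ m → Unique ps → All IsPerm ps →
  All (λ π → HasBlockTwins π m) ps → length ps * m ! ≤ n * n * n !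
count-twins n m ps 1≤m ps-unique ps-perm ps-twins = subst₂ _≤_
  (trans (length-cartesianProduct ps (perms m)) (cong (length ps *_) (length-perms m)))
  (trans (length-cartesianProduct (cartesianProduct (upTo n) (upTo n)) (perms n))
    (cong₂ _*_ (trans (length-cartesianProduct (upTo n) (upTo n)) (cong₂ _*_ (List.length-upTo n) (List.length-upTo n)))
      (length-perms n)))
  (injection⇒length≤ R (Unique.cartesianProduct⁺ ps-unique (perms-unique m)) total inj)
  where
  R : Vec (Fin n) n × Vec (Fin m) m → (ℕ × ℕ) × Vec (Fin n) n → Set
  R (π , σ) ((i , j) , ρ) = i + m ≤ n × j + m ≤ n × Disjoint i j m × Similar m (block π i) (block π j) × Rearranged j σ π ρ

  -- A nonempty block starts below `n`, so n² pairs of starting positions suffice.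
  start< : ∀ {i} → i + m ≤ n → i < n
  start< {i} i+m≤n = <-≤-trans (m<m+n i 1≤m) i+m≤n

  total : ∀ {x} → x ∈ cartesianProduct ps (perms m) →
    ∃[ y ] (y ∈ cartesianProduct (cartesianProduct (upTo n) (upTo n)) (perms n) × R x y)
  total x∈ =
    let π∈ , σ∈ = ∈.∈-cartesianProduct⁻ ps (perms m) x∈
        i , j , i+m≤n , j+m≤n , dis , s = All.lookup ps-twins π∈
        ρ , ρ-perm , r = rearrange j+m≤n (∈-perms⁻ m σ∈) (All.lookup ps-perm π∈)
    in _ , ∈.∈-cartesianProduct⁺
            (∈.∈-cartesianProduct⁺ (∈.∈-upTo⁺ (start< i+m≤n)) (∈.∈-upTo⁺ (start< j+m≤n))) (∈-perms⁺ n ρ-perm)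
        , i+m≤n , j+m≤n , dis , similar s , r

  inj : ∀ {x x′ y} → x ∈ cartesianProduct ps (perms m) → x′ ∈ cartesianProduct ps (perms m) →
    R x y → R x′ y → x ≡ x′
  inj x∈ x′∈ (i+m≤n , j+m≤n , dis , s , r) (_ , _ , _ , s′ , r′) =
    let π∈ , σ∈ = ∈.∈-cartesianProduct⁻ ps (perms m) x∈
        π′∈ , σ′∈ = ∈.∈-cartesianProduct⁻ ps (perms m) x′∈
        π≡ , σ≡ = rearranged-twins-injective i+m≤n j+m≤n dis (∈-perms⁻ m σ∈) (∈-perms⁻ m σ′∈)
                    (All.lookup ps-perm π∈) s s′ r r′
    in cong₂ _,_ π≡ σ≡

multiples-disjoint : ∀ m {s t} → s ≢ t → Disjoint (s * m) (t * m) m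
multiples-disjoint m {s} {t} s≢t with <-cmp s t
... | tri< lt _ _ = inj₁ (≤-trans (≤-reflexive (+-comm (s * m) m)) (*-monoˡ-≤ m lt))
... | tri≈ _ e _  = contradiction e s≢t
... | tri> _ _ gt = inj₂ (≤-trans (≤-reflexive (+-comm (t * m) m)) (*-monoˡ-≤ m gt))

-- Injection (2) sends `(π , (s , t))` to `(ρ , σ)`. The blocks start at multiples of `m`: the
-- pattern comes from one of the first `M`, and the rearranged block is one of the next `M`. These
-- are always disjoint, so the model block survives.
count-no-twins : ∀ n m M (ps : List (Vec (Fin n) n)) → (M + M) * m ≤ n → Unique ps → All IsPerm ps →
  All (λ π → ¬ HasBlockTwins π m) ps → length ps * (M * M) ≤ n ! * m !
count-no-twins n m M ps 2Mm≤n ps-unique ps-perm ps-twinless = subst₂ _≤_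
  (trans (length-cartesianProduct ps pairs) (cong (length ps *_)
    (trans (length-cartesianProduct (upTo M) (upTo M)) (cong₂ _*_ (List.length-upTo M) (List.length-upTo M)))))
  (trans (length-cartesianProduct (perms n) (perms m)) (cong₂ _*_ (length-perms n) (length-perms m)))
  (injection⇒length≤ R (Unique.cartesianProduct⁺ ps-unique (Unique.cartesianProduct⁺ (Unique.upTo⁺ M) (Unique.upTo⁺ M)))
    total inj)
  where
  pairs : List (ℕ × ℕ)
  pairs = cartesianProduct (upTo M) (upTo M)

  R : Vec (Fin n) n × (ℕ × ℕ) → Vec (Fin n) n × Vec (Fin m) m → Set
  R (π , (s , t)) (ρ , σ) =
    IsPerm σ × Rearranged ((M + t) * m) σ π ρ × Similar m (block ρ (s * m)) (block ρ ((M + t) * m))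

  fits : ∀ {u} → u < M + M → u * m + m ≤ n
  fits {u} u< = ≤-trans (≤-trans (≤-reflexive (+-comm (u * m) m)) (*-monoˡ-≤ m u<)) 2Mm≤n

  s≢M+t : ∀ {s} t → s < M → s ≢ M + t
  s≢M+t t s<M refl = <⇒≱ s<M (m≤m+n M t)

  fitsˡ : ∀ {s} → s < M → s * m + m ≤ n
  fitsˡ s<M = fits (<-≤-trans s<M (m≤m+n M M))

  fitsʳ : ∀ {t} → t < M → (M + t) * m + m ≤ n
  fitsʳ t<M = fits (+-monoʳ-< M t<M)

  block-injective : ∀ {π : Vec (Fin n) n} {i} → IsPerm π → i + m ≤ n → InjectiveBelow m (block π i)
  block-injective {i = i} π-perm fit a<m b<m e =
    +-cancelˡ-≡ i _ _ (val-injective π-perm (block< fit a<m) (block< fit b<m) e)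

  members : ∀ {π s t} → (π , (s , t)) ∈ cartesianProduct ps pairs → π ∈ ps × s < M × t < M
  members x∈ =
    let π∈ , st∈ = ∈.∈-cartesianProduct⁻ ps pairs x∈
        s∈ , t∈ = ∈.∈-cartesianProduct⁻ (upTo M) (upTo M) st∈
    in π∈ , ∈.∈-upTo⁻ s∈ , ∈.∈-upTo⁻ t∈

  total : ∀ {x} → x ∈ cartesianProduct ps pairs → ∃[ y ] (y ∈ cartesianProduct (perms n) (perms m) × R x y)
  total {π , (s , t)} x∈ =
    let π∈ , s<M , t<M = members x∈
        π-perm = All.lookup ps-perm π∈
        σ , σ-perm , sim = sort-like (block-injective π-perm (fitsʳ t<M)) (block-injective π-perm (fitsˡ s<M))
        ρ , ρ-perm , r = rearrange (fitsʳ t<M) σ-perm π-perm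
    in (ρ , σ) , ∈.∈-cartesianProduct⁺ (∈-perms⁺ n ρ-perm) (∈-perms⁺ m σ-perm) , σ-perm , r ,
      similar-trans (outside-similar (fitsˡ s<M) (multiples-disjoint m (s≢M+t t s<M)) r)
        (similar-trans sim (similar-≗ (λ a<m → sym (inside r a<m))))

  inj : ∀ {x x′ y} → x ∈ cartesianProduct ps pairs → x′ ∈ cartesianProduct ps pairs → R x y → R x′ y → x ≡ x′
  inj {π , (s , t)} {π′ , (s′ , t′)} {ρ , σ} x∈ x′∈ (σ-perm , r , sim) (_ , r′ , sim′) =
    let π∈ , s<M , t<M = members x∈
        π′∈ , s′<M , _ = members x′∈
    in decide π∈ π′∈ s<M t<M s′<M (t ≟ t′) (s ≟ s′) r r′ sim′
    where
    decide : π ∈ ps → π′ ∈ ps → s < M → t < M → s′ < M → Dec (t ≡ t′) → Dec (s ≡ s′) →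
      Rearranged ((M + t) * m) σ π ρ → Rearranged ((M + t′) * m) σ π′ ρ →
      Similar m (block ρ (s′ * m)) (block ρ ((M + t′) * m)) →
      (π , (s , t)) ≡ (π′ , (s′ , t′))
    decide π∈ π′∈ s<M t<M s′<M (yes refl) (yes refl) r r′ sim′ = cong (_, (s , t)) (rearranged-injective σ-perm r r′)
    -- In `ρ` the blocks `s` and `s′` both resemble block `M + t`. The rearrangement leaves them
    -- alone, so they would be twins in `π`.
    decide π∈ π′∈ s<M t<M s′<M (yes refl) (no s≢s′) r r′ sim′ = contradiction
      (s * m , s′ * m , fitsˡ s<M , fitsˡ s′<M , multiples-disjoint m s≢s′ , order s~s′)
      (All.lookup ps-twinless π∈)
      where
      s~s′ : Similar m (block π (s * m)) (block π (s′ * m))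
      s~s′ = similar-trans (similar-sym (outside-similar (fitsˡ s<M) (multiples-disjoint m (s≢M+t t s<M)) r))
        (similar-trans sim (similar-trans (similar-sym sim′)
          (outside-similar (fitsˡ s′<M) (multiples-disjoint m (s≢M+t t s′<M)) r)))
    -- Passing from `π′` to `ρ` changes only block `M + t′`. So the similar blocks `s` and `M + t`
    -- of `ρ` would already be twins in `π′`.
    decide π∈ π′∈ s<M t<M s′<M (no t≢t′) _ r r′ sim′ = contradiction
      (s * m , (M + t) * m , fitsˡ s<M , fitsʳ t<M , multiples-disjoint m (s≢M+t t s<M) , order s~M+t)
      (All.lookup ps-twinless π′∈)
      where
      s~M+t : Similar m (block π′ (s * m)) (block π′ ((M + t) * m))
      s~M+t = similar-trans (similar-sym (outside-similar (fitsˡ s<M) (multiples-disjoint m (s≢M+t t′ s<M)) r′))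
        (similar-trans sim (outside-similar (fitsʳ t<M) (multiples-disjoint m (t≢t′ ∘ +-cancelˡ-≡ M _ _)) r′))

-- Monotonicity and decidability of block twins

twins-mono : ∀ (π : Vec (Fin n) n) {k k′} → k′ ≤ k → HasBlockTwins π k → HasBlockTwins π k′
twins-mono π k′≤k (i , j , fit , fit′ , dis , s) =
  i , j , ≤-trans (+-monoʳ-≤ i k′≤k) fit , ≤-trans (+-monoʳ-≤ j k′≤k) fit′ , shrink dis ,
  λ a b a< b< → s a b (<-≤-trans a< k′≤k) (<-≤-trans b< k′≤k)
  where
  shrink : Disjoint i j _ → Disjoint i j _
  shrink (inj₁ le) = inj₁ (≤-trans (+-monoʳ-≤ i k′≤k) le)
  shrink (inj₂ le) = inj₂ (≤-trans (+-monoʳ-≤ j k′≤k) le)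

similar? : ∀ m f g → Dec (Similar m f g)
similar? m f g = map′ (λ h → similar λ a b a< b< → h {a} a< {b} b<) (λ s {a} a< {b} b< → order s a b a< b<)
  (allUpTo? (λ a → allUpTo? (λ b → map′ (λ (p , q) → mk⇔ p q) (λ e → to e , from e)
    ((f a <? f b →-dec g a <? g b) ×-dec (g a <? g b →-dec f a <? f b))) m) m)

twins? : ∀ m (π : Vec (Fin n) n) → Dec (HasBlockTwins π m)
twins? {n} m π = map′ (λ (i , _ , j , _ , h) → i , j , h)
  -- Empty blocks may start at `n` itself, hence the search bound `suc n`.
  (λ (i , j , fit , fit′ , h) → i , s≤s (m+n≤o⇒m≤o i fit) , j , s≤s (m+n≤o⇒m≤o j fit′) , fit , fit′ , h)
  (anyUpTo? (λ i → anyUpTo? (λ j →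
    i + m ≤? n ×-dec j + m ≤? n ×-dec (i + m ≤? j ⊎-dec j + m ≤? i) ×-dec map′ order similar (similar? m (block π i) (block π j))) (suc n)) (suc n))

maximum : {P : ℕ → Set} → Decidable P → ∀ {a} → P a → ∀ B → (∀ k → P k → k ≤ B) → ∃[ b ] (P b × (∀ k → P k → k ≤ b))
maximum {P} P? {a} pa zero bound = zero , subst P (n≤0⇒n≡0 (bound a pa)) pa , bound
maximum P? pa (suc B) bound with P? (suc B)
... | yes p = suc B , p , bound
... | no ¬p = maximum P? pa B λ k pk → ≤-pred (≤∧≢⇒< (bound k pk) λ { refl → ¬p pk })

-- Growth estimates

1≤2^ : ∀ n → 1 ≤ 2 ^ n
1≤2^ n = m^n>0 2 n

1+n≤2^n : ∀ n → suc n ≤ 2 ^ n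
1+n≤2^n zero    = ≤-refl
1+n≤2^n (suc n) = begin
  suc (suc n)    ≤⟨ +-mono-≤ (1≤2^ n) (1+n≤2^n n) ⟩
  2 ^ n + 2 ^ n  ≡⟨ cong (2 ^ n +_) (+-identityʳ (2 ^ n)) ⟨
  2 ^ suc n      ∎
  where open ≤-Reasoning

-- At p = 4K the left side is at most (2K + 1)², and 2K + 1 ≤ 2^(2K). Each further step at most
-- doubles the left side and exactly doubles the right.
linear≤exponential : ∀ K {p} → 4 * K ≤ p → K * suc p ≤ 2 ^ p
linear≤exponential K {p} 4K≤p = subst (λ x → K * suc x ≤ 2 ^ x) (m∸n+n≡m 4K≤p) (go (p ∸ 4 * K))
  where
  open ≤-Reasoning
  go : ∀ r → K * suc (r + 4 * K) ≤ 2 ^ (r + 4 * K)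
  go zero = begin
    K * suc (4 * K)                ≤⟨ m≤m+n _ _ ⟩
    K * suc (4 * K) + (3 * K + 1)  ≡⟨ square K ⟩
    suc (2 * K) * suc (2 * K)      ≤⟨ *-mono-≤ (1+n≤2^n (2 * K)) (1+n≤2^n (2 * K)) ⟩
    2 ^ (2 * K) * 2 ^ (2 * K)      ≡⟨ ^-distribˡ-+-* 2 (2 * K) (2 * K) ⟨
    2 ^ (2 * K + 2 * K)            ≡⟨ cong (2 ^_) (double K) ⟩
    2 ^ (4 * K)                    ∎
    where
    square : ∀ K → K * suc (4 * K) + (3 * K + 1) ≡ suc (2 * K) * suc (2 * K)
    square = solve-∀
    double : ∀ K → 2 * K + 2 * K ≡ 4 * K
    double = solve-∀
  go (suc r) = begin
    K * suc (suc r + 4 * K)        ≤⟨ *-monoʳ-≤ K (s≤s (m≤m+n _ (r + 4 * K))) ⟩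
    K * suc (suc r + 4 * K + (r + 4 * K)) ≡⟨ double K r ⟩
    2 * (K * suc (r + 4 * K))      ≤⟨ *-monoʳ-≤ 2 (go r) ⟩
    2 ^ (suc r + 4 * K)            ∎
    where
    double : ∀ K r → K * suc (suc r + 4 * K + (r + 4 * K)) ≡ 2 * (K * suc (r + 4 * K))
    double = solve-∀

2*⌊n/2⌋≤n : ∀ n → 2 * ⌊ n /2⌋ ≤ n
2*⌊n/2⌋≤n zero          = z≤n
2*⌊n/2⌋≤n (suc zero)    = z≤n
2*⌊n/2⌋≤n (suc (suc n)) = ≤-trans (≤-reflexive (*-suc 2 ⌊ n /2⌋)) (s≤s (s≤s (2*⌊n/2⌋≤n n)))

2^⌊log₂n⌋≤n : ∀ {n} → 1 ≤ n → 2 ^ ⌊log₂ n ⌋ ≤ n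
2^⌊log₂n⌋≤n {n} 1≤n = go n 1≤n ≤-refl
  where
  open ≤-Reasoning
  -- An inequality covers `l = 0` as well, where `l ∸ 1` is truncated to 0.
  pred-exponent : ∀ l → 2 ^ l ≤ 2 * 2 ^ (l ∸ 1)
  pred-exponent zero    = s≤s z≤n
  pred-exponent (suc l) = ≤-refl
  go : ∀ bound {n} → 1 ≤ n → n ≤ bound → 2 ^ ⌊log₂ n ⌋ ≤ n
  go (suc bound) {suc zero} _ _ = ≤-refl
  go (suc bound) {n@(suc (suc n′))} _ (s≤s n′<bound) = begin
    2 ^ ⌊log₂ n ⌋              ≤⟨ pred-exponent ⌊log₂ n ⌋ ⟩
    2 * 2 ^ (⌊log₂ n ⌋ ∸ 1)    ≡⟨ cong (λ l → 2 * 2 ^ l) (⌊log₂⌊n/2⌋⌋≡⌊log₂n⌋∸1 n) ⟨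
    2 * 2 ^ ⌊log₂ ⌊ n /2⌋ ⌋    ≤⟨ *-monoʳ-≤ 2 (go bound (s≤s z≤n) (≤-trans (s≤s (⌊n/2⌋≤n n′)) n′<bound)) ⟩
    2 * ⌊ n /2⌋                ≤⟨ 2*⌊n/2⌋≤n n ⟩
    n                          ∎

n<2^[1+⌊log₂n⌋] : ∀ n → n < 2 ^ suc ⌊log₂ n ⌋
n<2^[1+⌊log₂n⌋] n = ≰⇒> λ le → 1+n≰n (subst (_≤ ⌊log₂ n ⌋) (⌊log₂[2^n]⌋≡n (suc ⌊log₂ n ⌋)) (⌊log₂⌋-mono-≤ le))

⌊log₂⌋-lower : ∀ {l n} → 2 ^ l ≤ n → l ≤ ⌊log₂ n ⌋
⌊log₂⌋-lower {l} le = subst (_≤ _) (⌊log₂[2^n]⌋≡n l) (⌊log₂⌋-mono-≤ le)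

-- At most r of the factors of m ! are less than r.
r^m≤m!*r^r : ∀ r .{{_ : NonZero r}} m → r ^ m ≤ m ! * r ^ r
r^m≤m!*r^r r zero = ≤-trans (m^n>0 r r) (≤-reflexive (sym (+-identityʳ _)))
r^m≤m!*r^r r (suc m) with r ≤? suc m
... | yes r≤1+m = ≤-trans (*-mono-≤ r≤1+m (r^m≤m!*r^r r m)) (≤-reflexive (sym (*-assoc (suc m) (m !) _)))
... | no r≰1+m  = ≤-trans (^-monoʳ-≤ r (<⇒≤ (≰⇒> r≰1+m))) (m≤n*m (r ^ r) (suc m !) {{suc m !≢0}})

m!≤m^m : ∀ m → m ! ≤ m ^ m
m!≤m^m zero    = ≤-refl
m!≤m^m (suc m) = *-monoʳ-≤ (suc m) (≤-trans (m!≤m^m m) (^-monoˡ-≤ m (n≤1+n m)))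

-- Factorials at the two critical lengths

-- The hypotheses describe Λ and ℓ as integer parts of binary logarithms by comparison with powers
-- of 2, so that both estimates reduce to inequalities between exponents.
module _ {k d n Λ ℓ : ℕ} (1≤k : 1 ≤ k)
         (2^Λ≤n : 2 ^ Λ ≤ n) (n<2^1+Λ : n < 2 ^ suc Λ) (2^ℓ≤Λ : 2 ^ ℓ ≤ Λ) (Λ<2^1+ℓ : Λ < 2 ^ suc ℓ)
         (5≤ℓ : 5 ≤ ℓ) where

  private
    instance
      k≢0 : NonZero k
      k≢0 = >-nonZero 1≤k

  -- The base r = 2 ^ q is chosen so that q ≈ ℓ (q loses only a
  -- 1/(4k+2) fraction of ℓ) while q · 2 ^ q is negligible against Λ.
  factorial-large : ∀ {m} → let p = ℓ / suc (4 * k + 1) in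
    4 * k * ℓ ≤ 2 ^ p → 4 * k * (3 + d) ≤ Λ → (2 * k + 1) * Λ ≤ k * m * ℓ → 2 * d * (n * n) ≤ m !
  factorial-large {m} 4kℓ≤2^p 4k[3+d]≤Λ m-large =
    -- The cancelled factor is the r^r of `r^m≤m!*r^r`, with r = 2^q. All other factors are bounded
    -- by powers of 2.
    *-cancelʳ-≤ _ _ ((2 ^ q) ^ (2 ^ q)) {{>-nonZero (m^n>0 (2 ^ q) {{m^n≢0 2 q}} (2 ^ q))}} (begin
      2 * d * (n * n) * (2 ^ q) ^ (2 ^ q)                          ≤⟨ *-monoˡ-≤ _ (*-mono-≤ (*-monoʳ-≤ 2 (<⇒≤ (1+n≤2^n d))) (*-mono-≤ (<⇒≤ n<2^1+Λ) (<⇒≤ n<2^1+Λ))) ⟩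
      2 * 2 ^ d * (2 ^ suc Λ * 2 ^ suc Λ) * (2 ^ q) ^ (2 ^ q)      ≡⟨ cong₂ _*_ (trans (cong (2 ^ suc d *_) (sym (^-distribˡ-+-* 2 (suc Λ) (suc Λ)))) (sym (^-distribˡ-+-* 2 (suc d) (suc Λ + suc Λ)))) (^-*-assoc 2 q (2 ^ q)) ⟩
      2 ^ (suc d + (suc Λ + suc Λ)) * 2 ^ (q * 2 ^ q)          ≡⟨ ^-distribˡ-+-* 2 (suc d + (suc Λ + suc Λ)) (q * 2 ^ q) ⟨
      2 ^ (suc d + (suc Λ + suc Λ) + q * 2 ^ q)                ≤⟨ ^-monoʳ-≤ 2 (*-cancelˡ-≤ (4 * k) exponents) ⟩
      2 ^ (q * m)                                              ≡⟨ ^-*-assoc 2 q m ⟨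
      (2 ^ q) ^ m                                                ≤⟨ r^m≤m!*r^r (2 ^ q) {{m^n≢0 2 q}} m ⟩
      m ! * (2 ^ q) ^ (2 ^ q)                                      ∎)
    where
    open ≤-Reasoning
    c p q : ℕ
    c = suc (4 * k + 1)
    p = ℓ / c
    q = ℓ ∸ p

    instance
      4k≢0 : NonZero (4 * k)
      4k≢0 = m*n≢0 4 k

    p+q≡ℓ : p + q ≡ ℓ
    p+q≡ℓ = m+[n∸m]≡n (≤-trans (m≤m*n p c) (m/n*n≤m ℓ c))

    -- From pc ≤ ℓ: cq = cℓ - cp ≥ (c - 1)ℓ.
    q-large : (4 * k + 1) * ℓ ≤ c * q
    q-large = +-cancelˡ-≤ (p * c) _ _ (begin
      p * c + (4 * k + 1) * ℓ  ≤⟨ +-monoˡ-≤ _ (m/n*n≤m ℓ c) ⟩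
      c * ℓ                    ≡⟨ cong (c *_) p+q≡ℓ ⟨
      c * (p + q)              ≡⟨ *-distribˡ-+ c p q ⟩
      c * p + c * q            ≡⟨ cong (_+ c * q) (*-comm c p) ⟩
      p * c + c * q            ∎)

    -- That is, qm ≥ (2 + 1/(2k))Λ. The choice c = 2(2k + 1) makes the factor 2k + 1 cancel.
    main : (4 * k + 1) * Λ ≤ 2 * k * (q * m)
    main = *-cancelˡ-≤ (suc (2 * k)) (begin
      suc (2 * k) * ((4 * k + 1) * Λ)     ≡⟨ lhs k Λ ⟩
      (4 * k + 1) * ((2 * k + 1) * Λ)     ≤⟨ *-monoʳ-≤ (4 * k + 1) m-large ⟩
      (4 * k + 1) * (k * m * ℓ)           ≡⟨ mid k m ℓ ⟩
      k * m * ((4 * k + 1) * ℓ)           ≤⟨ *-monoʳ-≤ (k * m) q-large ⟩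
      k * m * (c * q)                     ≡⟨ rhs k m q ⟩
      suc (2 * k) * (2 * k * (q * m))     ∎)
      where
      lhs : ∀ k Λ → suc (2 * k) * ((4 * k + 1) * Λ) ≡ (4 * k + 1) * ((2 * k + 1) * Λ)
      lhs = solve-∀
      mid : ∀ k m ℓ → (4 * k + 1) * (k * m * ℓ) ≡ k * m * ((4 * k + 1) * ℓ)
      mid = solve-∀
      rhs : ∀ k m q → k * m * (suc (4 * k + 1) * q) ≡ suc (2 * k) * (2 * k * (q * m))
      rhs = solve-∀

    -- The factor 2^p absorbs 4kq, and 2^p · 2^q = 2^ℓ ≤ Λ.
    small : 4 * k * (q * 2 ^ q) ≤ Λ
    small = begin
      4 * k * (q * 2 ^ q)  ≡⟨ *-assoc (4 * k) q (2 ^ q) ⟨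
      4 * k * q * 2 ^ q    ≤⟨ *-monoˡ-≤ (2 ^ q) (≤-trans (*-monoʳ-≤ (4 * k) (m∸n≤m ℓ p)) 4kℓ≤2^p) ⟩
      2 ^ p * 2 ^ q        ≡⟨ ^-distribˡ-+-* 2 p q ⟨
      2 ^ (p + q)          ≡⟨ cong (2 ^_) p+q≡ℓ ⟩
      2 ^ ℓ                ≤⟨ 2^ℓ≤Λ ⟩
      Λ                    ∎

    -- The surplus Λ/(2k) in `main` pays Λ/(4k) for the constant 3 + d and Λ/(4k) for q · 2^q.
    exponents : 4 * k * (suc d + (suc Λ + suc Λ) + q * 2 ^ q) ≤ 4 * k * (q * m)
    exponents = begin
      4 * k * (suc d + (suc Λ + suc Λ) + q * 2 ^ q)              ≡⟨ lhs k d Λ (q * 2 ^ q) ⟩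
      4 * k * (3 + d) + 8 * k * Λ + 4 * k * (q * 2 ^ q)          ≤⟨ +-mono-≤ (+-monoˡ-≤ _ 4k[3+d]≤Λ) small ⟩
      Λ + 8 * k * Λ + Λ                                          ≡⟨ mid k Λ ⟩
      2 * ((4 * k + 1) * Λ)                                      ≤⟨ *-monoʳ-≤ 2 main ⟩
      2 * (2 * k * (q * m))                                      ≡⟨ rhs k (q * m) ⟩
      4 * k * (q * m)                                            ∎
      where
      lhs : ∀ k d Λ x → 4 * k * (suc d + (suc Λ + suc Λ) + x) ≡ 4 * k * (3 + d) + 8 * k * Λ + 4 * k * x
      lhs = solve-∀
      mid : ∀ k Λ → Λ + 8 * k * Λ + Λ ≡ 2 * ((4 * k + 1) * Λ)
      mid = solve-∀
      rhs : ∀ k x → 2 * (2 * k * x) ≡ 4 * k * x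
      rhs = solve-∀

  -- Since m ≤ 2^ℓ, m! ≤ m^m ≤ 2^(ℓm), where ℓm ≤ (2 - 1/k)Λ + ℓ. The remaining factors 2d and 16m²
  -- add at most d + 5 + 2ℓ to the exponent, so the loss d + 5 + 3ℓ has to fit into Λ/k. The 16m²
  -- comes from squaring n ≤ 4Mm.
  factorial-small : ∀ {m} .{{_ : NonZero (m + m)}} → 1 ≤ m → k * (d + 5 + 3 * ℓ) ≤ Λ →
    m * (k * ℓ) ≤ (2 * k ∸ 1) * Λ + k * ℓ → 2 * d * m ! ≤ (n / (m + m)) * (n / (m + m))
  factorial-small {m} 1≤m Λ-large m-small =
    *-cancelʳ-≤ _ _ (16 * (m * m)) (begin
      2 * d * m ! * (16 * (m * m))                ≤⟨ *-monoˡ-≤ _ (*-mono-≤ (*-monoʳ-≤ 2 (<⇒≤ (1+n≤2^n d))) (m!≤m^m m)) ⟩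
      2 ^ suc d * m ^ m * (16 * (m * m))          ≤⟨ *-mono-≤ (*-monoʳ-≤ (2 ^ suc d) (^-monoˡ-≤ m m≤2^ℓ)) (*-monoʳ-≤ 16 (*-mono-≤ m≤2^ℓ m≤2^ℓ)) ⟩
      2 ^ suc d * (2 ^ ℓ) ^ m * (2 ^ 4 * (2 ^ ℓ * 2 ^ ℓ))  ≡⟨ cong₂ _*_ (trans (cong (2 ^ suc d *_) (^-*-assoc 2 ℓ m)) (sym (^-distribˡ-+-* 2 (suc d) (ℓ * m)))) (trans (cong (16 *_) (sym (^-distribˡ-+-* 2 ℓ ℓ))) (sym (^-distribˡ-+-* 2 4 (ℓ + ℓ)))) ⟩
      2 ^ (suc d + ℓ * m) * 2 ^ (4 + (ℓ + ℓ))     ≡⟨ ^-distribˡ-+-* 2 (suc d + ℓ * m) (4 + (ℓ + ℓ)) ⟨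
      2 ^ (suc d + ℓ * m + (4 + (ℓ + ℓ)))         ≤⟨ ^-monoʳ-≤ 2 (*-cancelˡ-≤ k exponents) ⟩
      2 ^ (Λ + Λ)                                 ≡⟨ ^-distribˡ-+-* 2 Λ Λ ⟩
      2 ^ Λ * 2 ^ Λ                               ≤⟨ *-mono-≤ 2^Λ≤n 2^Λ≤n ⟩
      n * n                                       ≤⟨ *-mono-≤ n≤4Mm n≤4Mm ⟩
      4 * (M * m) * (4 * (M * m))                 ≡⟨ rhs M m ⟩
      M * M * (16 * (m * m))                      ∎)
    where
    open ≤-Reasoning
    M : ℕ
    M = n / (m + m)

    instance
      m≢0 : NonZero m
      m≢0 = >-nonZero 1≤m
      ℓ≢0 : NonZero ℓ
      ℓ≢0 = >-nonZero (≤-trans (s≤s z≤n) 5≤ℓ)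
      mm≢0 : NonZero (m * m)
      mm≢0 = m*n≢0 m m
      16mm≢0 : NonZero (16 * (m * m))
      16mm≢0 = m*n≢0 16 (m * m)

    rhs : ∀ M m → 4 * (M * m) * (4 * (M * m)) ≡ M * M * (16 * (m * m))
    rhs = solve-∀

    2k-1+1 : 2 * k ∸ 1 + 1 ≡ 2 * k
    2k-1+1 = m∸n+n≡m (≤-trans 1≤k (m≤n*m k 2))

    ℓ≤2^ℓ : ℓ ≤ 2 ^ ℓ
    ℓ≤2^ℓ = <⇒≤ (1+n≤2^n ℓ)

    -- Here mℓ ≤ 2Λ + ℓ ≤ 5 · 2^ℓ, and 5 ≤ ℓ.
    m≤2^ℓ : m ≤ 2 ^ ℓ
    m≤2^ℓ = *-cancelʳ-≤ m (2 ^ ℓ) ℓ (*-cancelʳ-≤ (m * ℓ) (2 ^ ℓ * ℓ) k (begin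
      m * ℓ * k                            ≡⟨ trans (*-assoc m ℓ k) (cong (m *_) (*-comm ℓ k)) ⟩
      m * (k * ℓ)                          ≤⟨ m-small ⟩
      (2 * k ∸ 1) * Λ + k * ℓ              ≤⟨ +-mono-≤ (*-mono-≤ (m∸n≤m (2 * k) 1) (<⇒≤ Λ<2^1+ℓ)) (*-monoʳ-≤ k ℓ≤2^ℓ) ⟩
      2 * k * (2 * 2 ^ ℓ) + k * 2 ^ ℓ      ≡⟨ five k (2 ^ ℓ) ⟩
      2 ^ ℓ * 5 * k                        ≤⟨ *-monoˡ-≤ k (*-monoʳ-≤ (2 ^ ℓ) 5≤ℓ) ⟩
      2 ^ ℓ * ℓ * k                        ∎))
      where
      five : ∀ k x → 2 * k * (2 * x) + k * x ≡ x * 5 * k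
      five = solve-∀

    m+m≤n : m + m ≤ n
    m+m≤n = begin
      m + m                  ≤⟨ +-mono-≤ m≤2^ℓ m≤2^ℓ ⟩
      2 ^ ℓ + 2 ^ ℓ          ≤⟨ +-mono-≤ 2^ℓ≤Λ 2^ℓ≤Λ ⟩
      Λ + Λ                  ≤⟨ Λ+Λ≤2^Λ Λ ⟩
      2 ^ Λ                  ≤⟨ 2^Λ≤n ⟩
      n                      ∎
      where
      Λ+Λ≤2^Λ : ∀ x → x + x ≤ 2 ^ x
      Λ+Λ≤2^Λ zero    = z≤n
      Λ+Λ≤2^Λ (suc x) = +-mono-≤ (1+n≤2^n x) (≤-trans (1+n≤2^n x) (m≤m+n _ 0))

    -- Since 2m ≤ n gives M ≥ 1, the remainder, below 2m, is at most 2mM.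
    n≤4Mm : n ≤ 4 * (M * m)
    n≤4Mm = begin
      n                              ≡⟨ m≡m%n+[m/n]*n n (m + m) ⟩
      n % (m + m) + M * (m + m)      ≤⟨ +-monoˡ-≤ _ (<⇒≤ (m%n<n n (m + m))) ⟩
      m + m + M * (m + m)            ≤⟨ +-monoˡ-≤ _ (m≤n*m (m + m) M {{>-nonZero (m≥n⇒m/n>0 m+m≤n)}}) ⟩
      M * (m + m) + M * (m + m)      ≡⟨ four M m ⟩
      4 * (M * m)                    ∎
      where
      four : ∀ M m → M * (m + m) + M * (m + m) ≡ 4 * (M * m)
      four = solve-∀

    exponents : k * (suc d + ℓ * m + (4 + (ℓ + ℓ))) ≤ k * (Λ + Λ)
    exponents = begin
      k * (suc d + ℓ * m + (4 + (ℓ + ℓ)))              ≡⟨ lhs k d ℓ m ⟩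
      m * (k * ℓ) + k * (d + 5 + 2 * ℓ)                ≤⟨ +-monoˡ-≤ _ m-small ⟩
      (2 * k ∸ 1) * Λ + k * ℓ + k * (d + 5 + 2 * ℓ)    ≡⟨ mid ((2 * k ∸ 1) * Λ) k d ℓ ⟩
      (2 * k ∸ 1) * Λ + k * (d + 5 + 3 * ℓ)            ≤⟨ +-monoʳ-≤ _ Λ-large ⟩
      (2 * k ∸ 1) * Λ + Λ                              ≡⟨ last (2 * k ∸ 1) Λ ⟩
      (2 * k ∸ 1 + 1) * Λ                              ≡⟨ cong (_* Λ) 2k-1+1 ⟩
      2 * k * Λ                                        ≡⟨ end k Λ ⟩
      k * (Λ + Λ)                                      ∎
      where
      lhs : ∀ k d ℓ m → k * (suc d + ℓ * m + (4 + (ℓ + ℓ))) ≡ m * (k * ℓ) + k * (d + 5 + 2 * ℓ)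
      lhs = solve-∀
      mid : ∀ x k d ℓ → x + k * ℓ + k * (d + 5 + 2 * ℓ) ≡ x + k * (d + 5 + 3 * ℓ)
      mid = solve-∀
      last : ∀ c Λ → c * Λ + Λ ≡ (c + 1) * Λ
      last = solve-∀
      end : ∀ k Λ → 2 * k * Λ ≡ k * (Λ + Λ)
      end = solve-∀

-- Concentration

between : ∀ n (m₀ m₁ : ℕ) → List (Vec (Fin n) n)
between n m₀ m₁ = filter (twins? m₀) (filter (∁? (twins? m₁)) (perms n))

-- The two counting inequalities leave at most n!/(2d) permutations with twins of length `m₁`, and
-- as many without twins of length `m₀`. Together they are at most a fraction 1/d of all.
length-between : ∀ {n m₀ m₁ d M} → 1 ≤ n → 1 ≤ m₁ → 1 ≤ d → (M + M) * m₀ ≤ n →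
  2 * d * (n * n) ≤ m₁ ! → 2 * d * m₀ ! ≤ M * M → (d ∸ 1) * n ! ≤ d * length (between n m₀ m₁)
-- Doubling and adding 2 · n! to both sides avoids subtraction: 2 + 2(d - 1) = 2d.
length-between {n} {m₀} {m₁} {d@(suc d′)} {M} 1≤n 1≤m₁ _ 2Mm₀≤n m₁-large m₀-small =
  *-cancelˡ-≤ 2 (+-cancelˡ-≤ (2 * n !) _ _ (begin
    2 * n ! + 2 * (d′ * n !)                                  ≡⟨ lhs d′ (n !) ⟩
    2 * d * n !                                               ≡⟨ cong (2 * d *_) (length-perms n) ⟨
    2 * d * length (perms n)                                  ≤⟨ *-monoʳ-≤ (2 * d) split ⟩
    2 * d * (length long + (length (between n m₀ m₁) + length short))  ≡⟨ mid (2 * d) (length long) _ (length short) ⟩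
    2 * d * length long + 2 * d * length short + 2 * d * length (between n m₀ m₁) ≤⟨ +-monoˡ-≤ _ (+-mono-≤ long-few short-few) ⟩
    n ! + n ! + 2 * d * length (between n m₀ m₁)              ≡⟨ rhs (n !) d (length (between n m₀ m₁)) ⟩
    2 * n ! + 2 * (d * length (between n m₀ m₁))              ∎))
  where
  open ≤-Reasoning
  instance
    nn≢0 : NonZero (n * n)
    nn≢0 = m*n≢0 n n {{>-nonZero 1≤n}} {{>-nonZero 1≤n}}

  long notLong short : List (Vec (Fin n) n)
  long    = filter (twins? m₁) (perms n)
  notLong = filter (∁? (twins? m₁)) (perms n)
  short   = filter (∁? (twins? m₀)) notLong

  split : length (perms n) ≤ length long + (length (between n m₀ m₁) + length short)
  split = ≤-trans (length-filter+∁ (twins? m₁) (perms n)) (+-monoʳ-≤ (length long) (length-filter+∁ (twins? m₀) notLong))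

  perms-perm : All IsPerm (perms n)
  perms-perm = All.tabulate (∈-perms⁻ n)

  long-few : 2 * d * length long ≤ n !
  long-few = *-cancelʳ-≤ _ _ (n * n) (begin
    2 * d * length long * (n * n)    ≡⟨ swap (2 * d) (length long) (n * n) ⟩
    length long * (2 * d * (n * n))  ≤⟨ *-monoʳ-≤ (length long) m₁-large ⟩
    length long * m₁ !               ≤⟨ count-twins n m₁ long 1≤m₁ (Unique.filter⁺ (twins? m₁) (perms-unique n))
                                          (All.filter⁺ (twins? m₁) perms-perm) (All.all-filter (twins? m₁) (perms n)) ⟩
    n * n * n !                      ≡⟨ *-comm (n * n) (n !) ⟩
    n ! * (n * n)                    ∎)
    where
    swap : ∀ x y z → x * y * z ≡ y * (x * z)
    swap = solve-∀

  short-few : 2 * d * length short ≤ n !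
  short-few = *-cancelʳ-≤ _ _ (m₀ !) {{m₀ !≢0}} (begin
    2 * d * length short * m₀ !    ≡⟨ swap (2 * d) (length short) (m₀ !) ⟩
    length short * (2 * d * m₀ !)  ≤⟨ *-monoʳ-≤ (length short) m₀-small ⟩
    length short * (M * M)         ≤⟨ count-no-twins n m₀ M short 2Mm₀≤n
                                        (Unique.filter⁺ (∁? (twins? m₀)) (Unique.filter⁺ (∁? (twins? m₁)) (perms-unique n)))
                                        (All.filter⁺ (∁? (twins? m₀)) (All.filter⁺ (∁? (twins? m₁)) perms-perm))
                                        (All.all-filter (∁? (twins? m₀)) notLong) ⟩
    n ! * m₀ !                     ∎)
    where
    swap : ∀ x y z → x * y * z ≡ y * (x * z)
    swap = solve-∀

  lhs : ∀ d′ x → 2 * x + 2 * (d′ * x) ≡ 2 * suc d′ * x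
  lhs = solve-∀
  mid : ∀ d x y z → d * (x + (y + z)) ≡ d * x + d * z + d * y
  mid = solve-∀
  rhs : ∀ x d y → x + x + 2 * d * y ≡ 2 * x + 2 * (d * y)
  rhs = solve-∀

-- Initial segments of twins are twins, so lacking length `m₁` excludes all longer ones. The lengths
-- are thus bounded, and their maximum exists.
bt-between : ∀ (π : Vec (Fin n) n) {m₀ m₁} → HasBlockTwins π m₀ → ¬ HasBlockTwins π m₁ →
  ∃[ b ] (IsBT π b × m₀ ≤ b × b < m₁)
bt-between π {m₀} {m₁} has lacks =
  let b , b-twins , b-max = maximum (λ m → twins? m π) has m₁ (λ k tw → <⇒≤ (below tw))
  in b , (b-twins , b-max) , b-max m₀ has , below b-twins
  where
  below : ∀ {k} → HasBlockTwins π k → k < m₁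
  below tw = ≰⇒> λ m₁≤k → lacks (twins-mono π m₁≤k tw)

-- Choice of the threshold and of the lengths

module _ (k d : ℕ) where

  -- `threshold` is a lower bound for ℓ with one summand per demand: 5 for `5≤ℓ`; 4K to apply
  -- `linear≤exponential` with K at ℓ; Pc so that ℓ/c ≥ P, as needed to apply it with 4kc at ℓ/c.
  c P K threshold : ℕ
  c = suc (4 * k + 1)
  P = 4 * (4 * k * c)
  K = k * (d + 5)
  threshold = 5 + 4 * K + P * c

  module _ (1≤k : 1 ≤ k) (1≤d : 1 ≤ d) (n : ℕ) (n-large : 2 ^ (2 ^ threshold) ≤ n) where
    open ≤-Reasoning

    Λ ℓ : ℕ
    Λ = L n
    ℓ = LL n

    2^t≤Λ : 2 ^ threshold ≤ Λ
    2^t≤Λ = ⌊log₂⌋-lower {2 ^ threshold} n-large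

    t≤ℓ : threshold ≤ ℓ
    t≤ℓ = ⌊log₂⌋-lower {threshold} 2^t≤Λ

    5≤ℓ : 5 ≤ ℓ
    5≤ℓ = ≤-trans (≤-trans (m≤m+n 5 (4 * K)) (m≤m+n _ (P * c))) t≤ℓ

    1≤n : 1 ≤ n
    1≤n = ≤-trans (1≤2^ (2 ^ threshold)) n-large

    2^Λ≤n : 2 ^ Λ ≤ n
    2^Λ≤n = 2^⌊log₂n⌋≤n 1≤n

    2^ℓ≤Λ : 2 ^ ℓ ≤ Λ
    2^ℓ≤Λ = 2^⌊log₂n⌋≤n (≤-trans (1≤2^ threshold) 2^t≤Λ)

    4K≤ℓ : 4 * K ≤ ℓ
    4K≤ℓ = ≤-trans (≤-trans (m≤n+m (4 * K) 5) (m≤m+n _ (P * c))) t≤ℓ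

    4k[3+d]≤Λ : 4 * k * (3 + d) ≤ Λ
    4k[3+d]≤Λ = begin
      4 * k * (3 + d)                 ≤⟨ m≤m+n _ (8 * k) ⟩
      4 * k * (3 + d) + 8 * k         ≡⟨ eq k d ⟩
      4 * K                           ≤⟨ 4K≤ℓ ⟩
      ℓ                               ≤⟨ <⇒≤ (1+n≤2^n ℓ) ⟩
      2 ^ ℓ                           ≤⟨ 2^ℓ≤Λ ⟩
      Λ                               ∎
      where
      eq : ∀ k d → 4 * k * (3 + d) + 8 * k ≡ 4 * (k * (d + 5))
      eq = solve-∀

    k[d+5+3ℓ]≤Λ : k * (d + 5 + 3 * ℓ) ≤ Λ
    k[d+5+3ℓ]≤Λ = begin
      k * (d + 5 + 3 * ℓ)                       ≤⟨ m≤m+n _ (k * (d * ℓ + 2 * ℓ)) ⟩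
      k * (d + 5 + 3 * ℓ) + k * (d * ℓ + 2 * ℓ) ≡⟨ eq k d ℓ ⟩
      K * suc ℓ                                 ≤⟨ linear≤exponential K 4K≤ℓ ⟩
      2 ^ ℓ                                     ≤⟨ 2^ℓ≤Λ ⟩
      Λ                                         ∎
      where
      eq : ∀ k d ℓ → k * (d + 5 + 3 * ℓ) + k * (d * ℓ + 2 * ℓ) ≡ k * (d + 5) * suc ℓ
      eq = solve-∀

    -- With p = ℓ/c rounded down, ℓ ≤ c(p + 1), so a linear function of p has to be compared with
    -- 2^p.
    4kℓ≤2^[ℓ/c] : 4 * k * ℓ ≤ 2 ^ (ℓ / c)
    4kℓ≤2^[ℓ/c] = begin
      4 * k * ℓ                       ≡⟨ cong (4 * k *_) (m≡m%n+[m/n]*n ℓ c) ⟩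
      4 * k * (ℓ % c + ℓ / c * c)     ≤⟨ *-monoʳ-≤ (4 * k) (+-monoˡ-≤ _ (<⇒≤ (m%n<n ℓ c))) ⟩
      4 * k * (suc (ℓ / c) * c)       ≡⟨ trans (cong (4 * k *_) (*-comm (suc (ℓ / c)) c)) (sym (*-assoc (4 * k) c _)) ⟩
      4 * k * c * suc (ℓ / c)         ≤⟨ linear≤exponential (4 * k * c) P≤ℓ/c ⟩
      2 ^ (ℓ / c)                     ∎
      where
      P≤ℓ/c : P ≤ ℓ / c
      P≤ℓ/c = subst (_≤ ℓ / c) (m*n/n≡m P c) (/-monoˡ-≤ c (≤-trans (m≤n+m (P * c) (5 + 4 * K)) t≤ℓ))

    instance
      kℓ≢0 : NonZero (k * ℓ)
      kℓ≢0 = m*n≢0 k ℓ {{>-nonZero 1≤k}} {{>-nonZero (≤-trans (s≤s z≤n) 5≤ℓ)}}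

    -- The least m with m · kℓ > x. It is positive, and b < m gives b · kℓ ≤ x, which turns the
    -- absence of twins of length `m₁` into the exact upper bound of `GoodBT`.
    length-above : ℕ → ℕ
    length-above x = suc (x / (k * ℓ))

    length-above-> : ∀ x → x ≤ length-above x * (k * ℓ)
    length-above-> x = begin
      x                                     ≡⟨ m≡m%n+[m/n]*n x (k * ℓ) ⟩
      x % (k * ℓ) + x / (k * ℓ) * (k * ℓ)   ≤⟨ +-monoˡ-≤ _ (<⇒≤ (m%n<n x (k * ℓ))) ⟩
      length-above x * (k * ℓ)              ∎

    length-above-≤ : ∀ x → length-above x * (k * ℓ) ≤ x + k * ℓ
    length-above-≤ x = ≤-trans (+-monoʳ-≤ (k * ℓ) (m/n*n≤m x (k * ℓ))) (≤-reflexive (+-comm (k * ℓ) x))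

    m₀ m₁ M : ℕ
    m₀ = length-above ((2 * k ∸ 1) * Λ)
    m₁ = length-above ((2 * k + 1) * Λ)
    M = n / (m₀ + m₀)

    rearrange-product : ∀ b → b * (k * ℓ) ≡ k * b * ℓ
    rearrange-product b = trans (sym (*-assoc b k ℓ)) (cong (_* ℓ) (*-comm b k))

    good-bt : ∀ (π : Vec (Fin n) n) → HasBlockTwins π m₀ → ¬ HasBlockTwins π m₁ → GoodBT k π
    good-bt π has lacks =
      let b , b-bt , m₀≤b , b<m₁ = bt-between π has lacks
      in b , b-bt ,
         subst ((2 * k ∸ 1) * Λ ≤_) (rearrange-product b)
           (≤-trans (length-above-> _) (*-monoˡ-≤ (k * ℓ) m₀≤b)) ,
         subst (_≤ (2 * k + 1) * Λ) (rearrange-product b)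
           (≤-trans (*-monoˡ-≤ (k * ℓ) (≤-pred b<m₁)) (m/n*n≤m _ (k * ℓ)))

    between-large : (d ∸ 1) * n ! ≤ d * length (between n m₀ m₁)
    between-large = length-between {n} {m₀} {m₁} {d} {M} 1≤n (s≤s z≤n) 1≤d
      (≤-trans (≤-reflexive (double M m₀)) (m/n*n≤m n (m₀ + m₀)))
      (factorial-large {d = d} 1≤k 2^Λ≤n (n<2^[1+⌊log₂n⌋] n) 2^ℓ≤Λ (n<2^[1+⌊log₂n⌋] Λ) 5≤ℓ 4kℓ≤2^[ℓ/c] 4k[3+d]≤Λ
        (subst ((2 * k + 1) * Λ ≤_) (rearrange-product m₁) (length-above-> _)))
      (factorial-small {d = d} 1≤k 2^Λ≤n (n<2^[1+⌊log₂n⌋] n) 2^ℓ≤Λ (n<2^[1+⌊log₂n⌋] Λ) 5≤ℓ (s≤s z≤n) k[d+5+3ℓ]≤Λ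
        (length-above-≤ _))
      where
      double : ∀ x y → (x + x) * y ≡ x * (y + y)
      double = solve-∀

    between-good : All (GoodBT k) (between n m₀ m₁)
    between-good = All.zipWith (λ {π} (has , lacks) → good-bt π has lacks)
      (All.all-filter (twins? m₀) (filter (∁? (twins? m₁)) (perms n)) ,
       All.filter⁺ (twins? m₀) (All.all-filter (∁? (twins? m₁)) (perms n)))

between-unique : ∀ n m₀ m₁ → Unique (between n m₀ m₁)
between-unique n m₀ m₁ = Unique.filter⁺ (twins? m₀) (Unique.filter⁺ (∁? (twins? m₁)) (perms-unique n))

between-perm : ∀ n m₀ m₁ → All IsPerm (between n m₀ m₁)
between-perm n m₀ m₁ = All.filter⁺ (twins? m₀) (All.filter⁺ (∁? (twins? m₁)) (All.tabulate (∈-perms⁻ n)))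

theorem3p5 : (k d : ℕ) → 1 ≤ k → 1 ≤ d → ∃[ N ] ((n : ℕ) → N ≤ n →
    ∃[ good ] (Unique {A = Vec (Fin n) n} good × All IsPerm good × All (GoodBT k) good
    × (d ∸ 1) * n ! ≤ d * length good))
-- The double exponential makes `LL n` at least `threshold k d`. The list of good permutations is
-- `between n m₀ m₁`, left to be inferred.
theorem3p5 k d 1≤k 1≤d = 2 ^ (2 ^ threshold k d) , λ n n-large →
  _ , between-unique n _ _ , between-perm n _ _ , between-good k d 1≤k 1≤d n n-large , between-large k d 1≤k 1≤d n n-large
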